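{- There is an absolute constant $c>0$ such that for every sufficiently large positive integer $n$ there exists an acyclic digraph $D$ on $n$ vertices whose underlying undirected graph is $3$-degenerate and such that \[ \vec{r}(D) \geq n^{c\frac{\log n}{\log \log n}}. \]
   Context: For an acyclic digraph $D$, the oriented Ramsey number $\vec{r}(D)$ is the minimum integer $N$ such that every tournament on $N$ vertices contains a copy of $D$. A graph is $3$-degenerate if every subgraph has a vertex of degree at most $3$. Logarithms are natural. -}

module Defs where

open import Data.Nat using (ℕ; zero; suc; _+_; _*_; _^_; _≤_)
open import Data.Nat.Logarithm using (⌊log₂_⌋)
open import Data.Bool using (Bool; true; false; _∨_; _∧_; not)
open import Data.Fin using (Fin)
open import Data.Fin.Subset using (Subset; Nonempty; _∈_; _∩_; ∣_∣)
open import Data.Vec using (tabulate)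
open import Data.Product using (Σ; ∃; ∃-syntax; _×_)
open import Relation.Nullary using (¬_)
open import Relation.Binary.PropositionalEquality using (_≡_; _≢_)
open import Function.Definitions using (Injective)

record Digraph (n : ℕ) : Set where
  field
    arc : Fin n → Fin n → Bool
open Digraph public

data Path {n : ℕ} (D : Digraph n) : Fin n → Fin n → Set where
  edge : ∀ {u v} → arc D u v ≡ true → Path D u v
  step : ∀ {u v w} → arc D u v ≡ true → Path D v w → Path D u w

Acyclic : ∀ {n} → Digraph n → Set
Acyclic {n} D = ∀ (v : Fin n) → ¬ Path D v v

uadj : ∀ {n} → Digraph n → Fin n → Fin n → Bool
uadj D u v = arc D u v ∨ arc D v u

nbhd : ∀ {n} → Digraph n → Fin n → Subset n
nbhd D v = tabulate (λ u → uadj D u v)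

ThreeDegenerate : ∀ {n} → Digraph n → Set
ThreeDegenerate {n} D =
  ∀ (S : Subset n) → Nonempty S →
    ∃[ v ] (v ∈ S × ∣ S ∩ nbhd D v ∣ ≤ 3)

IsTournament : ∀ {N} → Digraph N → Set
IsTournament {N} T =
  (∀ (i : Fin N) → arc T i i ≡ false) ×
  (∀ (i j : Fin N) → i ≢ j → arc T i j ≡ not (arc T j i))

Contains : ∀ {N n} → Digraph N → Digraph n → Set
Contains {N} {n} T D =
  Σ (Fin n → Fin N) λ f →
    Injective _≡_ _≡_ f × (∀ u v → arc D u v ≡ true → arc T (f u) (f v) ≡ true)

-- Every tournament on N vertices contains a copy of D.
-- The oriented Ramsey number is the least such N; thus
-- "r(D) ≥ M" is "∀ N → AllTournamentsContain N D → M ≤ N".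
AllTournamentsContain : ∀ {n} → ℕ → Digraph n → Set
AllTournamentsContain N D = ∀ (T : Digraph N) → IsTournament T → Contains T D

module Submission where

open import Defs
open import Data.Nat using (ℕ; zero; suc; _+_; _*_; _^_; _/_; _%_; _≤_; _<_; _<ᵇ_; z≤n; s≤s; NonZero; ⌊_/2⌋)
open import Data.Nat.DivMod using (m≡m%n+[m/n]*n; m%n<n; m/n*n≤m; m≥n⇒m/n>0)
open import Data.Nat.Induction using (<-wellFounded)
open import Data.Nat.ListAction using (sum)
open import Data.Nat.Logarithm using (⌊log₂_⌋; ⌊log₂⌋-mono-≤; ⌊log₂[2^n]⌋≡n)
open import Data.Nat.Logarithm.Core using (⌊log2⌋)
open import Data.Nat.Properties hiding (suc-injective; _≟_)
open import Data.Nat.Tactic.RingSolver using (solve-∀)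
open import Data.Bool using (Bool; true; false; not; if_then_else_)
open import Data.Bool.Properties using (not-involutive)
open import Data.Empty using (⊥; ⊥-elim)
open import Data.Fin as Fin using (Fin; zero; suc; _≟_; toℕ; _↑ˡ_; _↑ʳ_; splitAt; finToFun; funToFin)
import Data.Fin.Properties as Fin
open import Data.Fin.Subset using (Subset; inside; outside; ∣_∣; _∪_; _∩_; ⁅_⁆) renaming (_∈_ to _∈ₛ_)
open import Data.Fin.Subset.Properties using (_∈?_; x∈p∩q⁻; x∈p∪q⁺; x∈⁅x⁆; ∣⁅x⁆∣≡1; p⊆q⇒∣p∣≤∣q∣)
open import Data.List as List using (List; []; _∷_; length; filter; allFin)
open import Data.List.Properties using (length-map; length-filter; length-tabulate; length-take; tabulate-cong; tabulate-lookup)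
open import Data.List.Membership.Propositional using (_∈_)
open import Data.List.Membership.Propositional.Properties using (∈-map⁺; ∈-map⁻; ∈-filter⁺; ∈-filter⁻; ∈-allFin)
open import Data.List.Relation.Unary.All as All using (All; []; _∷_)
open import Data.List.Relation.Unary.AllPairs as AllPairs using (AllPairs; []; _∷_)
import Data.List.Relation.Unary.AllPairs.Properties as AllPairs
open import Data.List.Relation.Unary.Any using (here; there)
open import Data.List.Relation.Unary.Unique.DecPropositional using (unique?)
open import Data.List.Relation.Unary.Unique.Propositional using (Unique)
open import Data.Maybe using (Maybe; just; nothing)
open import Data.Maybe.Properties using (just-injective)
open import Data.Product using (Σ; ∃; ∃-syntax; _×_; _,_; proj₁; proj₂; uncurry)
open import Data.Product.Function.NonDependent.Propositional using (_×-↔_)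
import Data.Product.Properties as Product
open import Data.Sum using (_⊎_; inj₁; inj₂)
open import Data.Sum.Function.Propositional using (_⊎-↔_)
open import Data.Vec using (Vec; []; _∷_; _++_; head; tail; map; lookup; replicate; tabulate; _[_]≔_)
open import Data.Vec.Properties using (lookup-++ˡ; lookup-++ʳ; lookup-map; lookup-replicate; lookup∘update; lookup∘update′; lookup∘tabulate; []=⇒lookup)
open import Function using (_∘_; _↔_; Inverse)
open import Function.Definitions using (Injective)
open import Function.Properties.Inverse using (↔-refl; ↔-trans)
open import Induction.WellFounded using (Acc; acc)
open import Relation.Binary.PropositionalEquality
open import Relation.Nullary using (¬_; Dec; yes; no; does; contradiction; ¬?; ofʸ; ofⁿ)
open import Relation.Nullary.Decidable using (map′; _×-dec_; dec-true; dec-false)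

-- A tournament R on r = 2^ρ vertices without transitive subtournaments on 2ρ + 2 vertices exists by
-- the union bound. The host tournament is the k-th lexicographic power of R, on words of length k.
-- The digraph D has b base vertices and, for base vertices u < v and u' < v' with u ≤ u', a gadget
-- u → x → v, u' → y → v', x → y with its own x and y, each of degree at most 3. Colour the base
-- vertices of a copy of D by the first letters of their words. If u and v share a letter i, then so
-- does x, since R has no 2-cycle; hence if u' and v' share a letter j ≠ i, the arc x → y gives i → j
-- in R. So the letters used at least twice, ordered by first occurrence, form a transitive
-- subtournament, and one of at most 2ρ + 1 colour classes contains nearly a 1/(2ρ + 1) fraction of
-- the base. That class with its gadgets lives in the (k - 1)-st power. A base of size
-- b > (r + 1)(2ρ + 2)^k therefore cannot be embedded, although |D| = O(b⁴) and the host has r^k vertices.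

-- Tournaments without large transitive subtournaments

-- A pattern is a subcube of the `m`-dimensional Boolean cube: `just` fixes a coordinate, `nothing`
-- leaves it free. `volume` counts its points.
Pattern : ℕ → Set
Pattern = Vec (Maybe Bool)

volume : ∀ {m} → Pattern m → ℕ
volume []            = 1
volume (nothing ∷ e) = 2 * volume e
volume (just _ ∷ e)  = volume e

totalVolume : ∀ {m} → List (Pattern m) → ℕ
totalVolume = sum ∘ List.map volume

_Avoids_ : ∀ {m} → (Fin m → Bool) → Pattern m → Set
f Avoids e = ∃[ k ] lookup e k ≡ just (not (f k))

restrict : ∀ {m} → Bool → List (Pattern (suc m)) → List (Pattern m)
restrict b     []                    = []
restrict b     ((nothing ∷ e) ∷ E)    = e ∷ restrict b E
restrict true  ((just true ∷ e) ∷ E)  = e ∷ restrict true E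
restrict true  ((just false ∷ e) ∷ E) = restrict true E
restrict false ((just true ∷ e) ∷ E)  = restrict false E
restrict false ((just false ∷ e) ∷ E) = e ∷ restrict false E

totalVolume-restrict : ∀ {m} (E : List (Pattern (suc m))) →
  totalVolume (restrict true E) + totalVolume (restrict false E) ≡ totalVolume E
totalVolume-restrict [] = refl
totalVolume-restrict ((nothing ∷ e) ∷ E) = begin
  (v + x) + (v + y)  ≡⟨ regroup v x y ⟩
  2 * v + (x + y)    ≡⟨ cong (2 * v +_) (totalVolume-restrict E) ⟩
  2 * v + totalVolume E ∎
  where
  open ≡-Reasoning
  v = volume e
  x = totalVolume (restrict true E)
  y = totalVolume (restrict false E)
  regroup : ∀ v x y → (v + x) + (v + y) ≡ 2 * v + (x + y)
  regroup = solve-∀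
totalVolume-restrict ((just true ∷ e) ∷ E) =
  trans (+-assoc (volume e) _ _) (cong (volume e +_) (totalVolume-restrict E))
totalVolume-restrict ((just false ∷ e) ∷ E) = begin
  x + (v + y)  ≡⟨ regroup v x y ⟩
  v + (x + y)  ≡⟨ cong (v +_) (totalVolume-restrict E) ⟩
  v + totalVolume E ∎
  where
  open ≡-Reasoning
  v = volume e
  x = totalVolume (restrict true E)
  y = totalVolume (restrict false E)
  regroup : ∀ v x y → x + (v + y) ≡ v + (x + y)
  regroup = solve-∀

extend : ∀ {m} → Bool → (Fin m → Bool) → Fin (suc m) → Bool
extend b f zero    = b
extend b f (suc k) = f k

avoids-restrict : ∀ {m} b (f : Fin m → Bool) (E : List (Pattern (suc m))) →
  All (f Avoids_) (restrict b E) → All (extend b f Avoids_) E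
avoids-restrict b f [] _ = []
avoids-restrict b f ((nothing ∷ e) ∷ E) ((k , eq) ∷ rest) = (suc k , eq) ∷ avoids-restrict b f E rest
avoids-restrict true f ((just true ∷ e) ∷ E) ((k , eq) ∷ rest) = (suc k , eq) ∷ avoids-restrict true f E rest
avoids-restrict true f ((just false ∷ e) ∷ E) rest = (zero , refl) ∷ avoids-restrict true f E rest
avoids-restrict false f ((just true ∷ e) ∷ E) rest = (zero , refl) ∷ avoids-restrict false f E rest
avoids-restrict false f ((just false ∷ e) ∷ E) ((k , eq) ∷ rest) = (suc k , eq) ∷ avoids-restrict false f E rest

-- The method of conditional expectations: fix the coordinates one by one, always staying in a half-cube that the patterns cannot fill.
union-bound : ∀ {m} (E : List (Pattern m)) → totalVolume E < 2 ^ m →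
  ∃[ f ] All (f Avoids_) E
union-bound {zero} [] _ = (λ ()) , []
union-bound {zero} ([] ∷ E) (s≤s ())
union-bound {suc m} E small with totalVolume (restrict true E) <? 2 ^ m
... | yes lt = let f , av = union-bound (restrict true E) lt in
  extend true f , avoids-restrict true f E av
... | no ¬lt = let f , av = union-bound (restrict false E) lt in
  extend false f , avoids-restrict false f E av
  where
  open ≤-Reasoning
  lt : totalVolume (restrict false E) < 2 ^ m
  lt = +-cancelˡ-< (2 ^ m) _ _ (begin-strict
    2 ^ m + totalVolume (restrict false E)
      ≤⟨ +-monoˡ-≤ _ (≮⇒≥ ¬lt) ⟩
    totalVolume (restrict true E) + totalVolume (restrict false E)
      ≡⟨ totalVolume-restrict E ⟩
    totalVolume E
      <⟨ small ⟩
    2 ^ suc m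
      ≡⟨ cong (2 ^ m +_) (+-identityʳ (2 ^ m)) ⟩
    2 ^ m + 2 ^ m ∎)

-- The binomial coefficient of `r` over 2. The first `r` coordinates of `pairs (suc r)` stand for
-- the pairs that contain vertex `zero`, the others for the pairs of successors.
pairs : ℕ → ℕ
pairs zero    = zero
pairs (suc r) = r + pairs r

orient : ∀ {r} → (Fin (pairs r) → Bool) → Fin r → Fin r → Bool
orient {suc r} f zero    zero    = false
orient {suc r} f zero    (suc j) = f (j ↑ˡ pairs r)
orient {suc r} f (suc i) zero    = not (f (i ↑ˡ pairs r))
orient {suc r} f (suc i) (suc j) = orient (f ∘ (r ↑ʳ_)) i j

orient-irrefl : ∀ {r} (f : Fin (pairs r) → Bool) (i : Fin r) → orient f i i ≡ false
orient-irrefl {suc r} f zero    = refl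
orient-irrefl {suc r} f (suc i) = orient-irrefl (f ∘ (r ↑ʳ_)) i

orient-not : ∀ {r} (f : Fin (pairs r) → Bool) (i j : Fin r) → i ≢ j → orient f i j ≡ not (orient f j i)
orient-not f zero zero i≢j = contradiction refl i≢j
orient-not f zero (suc j) _ = sym (not-involutive _)
orient-not f (suc i) zero _ = refl
orient-not {suc r} f (suc i) (suc j) i≢j = orient-not (f ∘ (r ↑ʳ_)) i j (i≢j ∘ cong suc)

-- A partial ranking prescribes that higher ranked vertices beat lower ranked ones.
Ranking : ℕ → Set
Ranking = Vec (Maybe ℕ)

beats : Maybe ℕ → Maybe ℕ → Maybe Bool
beats (just a) (just c) = just (c <ᵇ a)
beats (just a) nothing  = nothing
beats nothing  _        = nothing

rankingPattern : ∀ {r} → Ranking r → Pattern (pairs r)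
rankingPattern []       = []
rankingPattern (x ∷ xs) = map (beats x) xs ++ rankingPattern xs

ranked : ∀ {r} → Ranking r → ℕ
ranked []             = zero
ranked (just _ ∷ xs)  = suc (ranked xs)
ranked (nothing ∷ xs) = ranked xs

volume-row-nothing : ∀ {r m} (xs : Ranking r) (e : Pattern m) →
  volume (map (beats nothing) xs ++ e) ≡ 2 ^ r * volume e
volume-row-nothing []       e = sym (+-identityʳ _)
volume-row-nothing {suc r} (x ∷ xs) e =
  trans (cong (2 *_) (volume-row-nothing xs e)) (sym (*-assoc 2 (2 ^ r) (volume e)))

volume-row-just : ∀ {r m} a (xs : Ranking r) (e : Pattern m) →
  volume (map (beats (just a)) xs ++ e) * 2 ^ ranked xs ≡ 2 ^ r * volume e
volume-row-just a [] e = *-comm (volume e) 1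
volume-row-just {suc r} a (nothing ∷ xs) e = begin
  2 * v * 2 ^ ranked xs    ≡⟨ *-assoc 2 v _ ⟩
  2 * (v * 2 ^ ranked xs)  ≡⟨ cong (2 *_) (volume-row-just a xs e) ⟩
  2 * (2 ^ r * volume e)   ≡⟨ *-assoc 2 (2 ^ r) (volume e) ⟨
  2 ^ suc r * volume e     ∎
  where
  open ≡-Reasoning
  v = volume (map (beats (just a)) xs ++ e)
volume-row-just {suc r} a (just c ∷ xs) e = begin
  v * (2 * 2 ^ ranked xs)  ≡⟨ regroup v (2 ^ ranked xs) ⟩
  2 * (v * 2 ^ ranked xs)  ≡⟨ cong (2 *_) (volume-row-just a xs e) ⟩
  2 * (2 ^ r * volume e)   ≡⟨ *-assoc 2 (2 ^ r) (volume e) ⟨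
  2 ^ suc r * volume e     ∎
  where
  open ≡-Reasoning
  v = volume (map (beats (just a)) xs ++ e)
  regroup : ∀ v x → v * (2 * x) ≡ 2 * (v * x)
  regroup = solve-∀

-- The fixed coordinates are exactly the pairs of ranked vertices; there are `pairs (ranked xs)` of
-- them, and each halves the cube.
volume-rankingPattern : ∀ {r} (xs : Ranking r) →
  volume (rankingPattern xs) * 2 ^ pairs (ranked xs) ≡ 2 ^ pairs r
volume-rankingPattern [] = refl
volume-rankingPattern {suc r} (nothing ∷ xs) = begin
  volume (map (beats nothing) xs ++ rankingPattern xs) * P  ≡⟨ cong (_* P) (volume-row-nothing xs (rankingPattern xs)) ⟩
  2 ^ r * volume (rankingPattern xs) * P                     ≡⟨ *-assoc (2 ^ r) _ _ ⟩
  2 ^ r * (volume (rankingPattern xs) * P)                   ≡⟨ cong (2 ^ r *_) (volume-rankingPattern xs) ⟩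
  2 ^ r * 2 ^ pairs r                                  ≡⟨ ^-distribˡ-+-* 2 r (pairs r) ⟨
  2 ^ (r + pairs r)                                    ∎
  where
  open ≡-Reasoning
  P = 2 ^ pairs (ranked xs)
volume-rankingPattern {suc r} (just a ∷ xs) = begin
  v * 2 ^ (s + pairs s)               ≡⟨ cong (v *_) (^-distribˡ-+-* 2 s (pairs s)) ⟩
  v * (2 ^ s * 2 ^ pairs s)           ≡⟨ *-assoc v _ _ ⟨
  v * 2 ^ s * 2 ^ pairs s             ≡⟨ cong (_* 2 ^ pairs s) (volume-row-just a xs (rankingPattern xs)) ⟩
  2 ^ r * volume (rankingPattern xs) * 2 ^ pairs s    ≡⟨ *-assoc (2 ^ r) _ _ ⟩
  2 ^ r * (volume (rankingPattern xs) * 2 ^ pairs s)  ≡⟨ cong (2 ^ r *_) (volume-rankingPattern xs) ⟩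
  2 ^ r * 2 ^ pairs r                           ≡⟨ ^-distribˡ-+-* 2 r (pairs r) ⟨
  2 ^ (r + pairs r)                             ∎
  where
  open ≡-Reasoning
  s = ranked xs
  v = volume (map (beats (just a)) xs ++ rankingPattern xs)

-- The witness that avoidance gives: an arc that the ranking prescribes and the tournament lacks.
-- `c≤a` is weak because `beats` resolves a tie in favour of the later vertex.
record Upset {r} (f : Fin (pairs r) → Bool) (xs : Ranking r) : Set where
  constructor upset
  field
    {i j}   : Fin r
    {a c}   : ℕ
    i≢j     : i ≢ j
    rank-i  : lookup xs i ≡ just a
    rank-j  : lookup xs j ≡ just c
    c≤a     : c ≤ a
    no-arc  : orient f i j ≡ false

upset-head : ∀ {r} (f : Fin (pairs (suc r)) → Bool) x (xs : Ranking r) j →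
  beats x (lookup xs j) ≡ just (not (f (j ↑ˡ pairs r))) → Upset f (x ∷ xs)
upset-head {r} f (just a) xs j eq with lookup xs j in rank-j
... | just c with c <ᵇ a | <ᵇ-reflects-< c a | f (j ↑ˡ pairs r) in fj
... | true  | ofʸ c<a | false = upset {i = zero} {j = suc j} (λ ()) refl rank-j (<⇒≤ c<a) fj
... | false | ofⁿ c≮a | true  = upset {i = suc j} {j = zero} (λ ()) rank-j refl (≮⇒≥ c≮a) (cong not fj)

avoids⇒upset : ∀ {r} (f : Fin (pairs r) → Bool) (xs : Ranking r) → f Avoids rankingPattern xs → Upset f xs
avoids⇒upset {suc r} f (x ∷ xs) (k , eq) with splitAt r k | Fin.join-splitAt r (pairs r) k
... | inj₁ j | refl = upset-head f x xs j
  (trans (sym (trans (lookup-++ˡ (map (beats x) xs) _ j) (lookup-map j (beats x) xs))) eq)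
... | inj₂ l | refl with avoids⇒upset (f ∘ (r ↑ʳ_)) xs
                           (l , trans (sym (lookup-++ʳ (map (beats x) xs) _ l)) eq)
...   | upset i≢j ri rj c≤a na = upset (i≢j ∘ Fin.suc-injective) ri rj c≤a na

-- The rank of an entry is the number of entries after its first occurrence, so forward arcs along
-- the list run from higher to lower ranks.
positions : ∀ {r} → List (Fin r) → Ranking r
positions []      = replicate _ nothing
positions (x ∷ v) = positions v [ x ]≔ just (length v)

positions-just : ∀ {r} (v : List (Fin r)) {i c} → lookup (positions v) i ≡ just c → i ∈ v × c < length v
positions-just [] {i} eq with () ← trans (sym (lookup-replicate i nothing)) eq
positions-just (x ∷ v) {i} eq with i ≟ x
... | yes refl = here refl , ≤-reflexive (cong suc (just-injective
  (trans (sym eq) (lookup∘update x (positions v) (just (length v))))))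
... | no i≢x = let i∈v , c<v = positions-just v (trans (sym (lookup∘update′ i≢x (positions v) _)) eq) in
  there i∈v , m<n⇒m<1+n c<v

ranked-update : ∀ {r} (xs : Ranking r) i a → lookup xs i ≡ nothing → ranked (xs [ i ]≔ just a) ≡ suc (ranked xs)
ranked-update (nothing ∷ xs) zero    a eq = refl
ranked-update (nothing ∷ xs) (suc i) a eq = ranked-update xs i a eq
ranked-update (just _ ∷ xs)  (suc i) a eq = cong suc (ranked-update xs i a eq)

ranked-replicate : ∀ r → ranked (replicate r nothing) ≡ 0
ranked-replicate zero    = refl
ranked-replicate (suc r) = ranked-replicate r

ranked-positions : ∀ {r} {v : List (Fin r)} → Unique v → ranked (positions v) ≡ length v
ranked-positions {r} [] = ranked-replicate r
ranked-positions {v = x ∷ v} (x∉v ∷ v!) =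
  trans (ranked-update (positions v) x _ unranked) (cong suc (ranked-positions v!))
  where
  unranked : lookup (positions v) x ≡ nothing
  unranked with lookup (positions v) x in eq
  ... | nothing = refl
  ... | just c  = ⊥-elim (All.lookup x∉v (proj₁ (positions-just v eq)) refl)

positions-arc : ∀ {r} {_⇝_ : Fin r → Fin r → Set} {v} → AllPairs _⇝_ v → ∀ {i j a c} → i ≢ j →
  lookup (positions v) i ≡ just a → lookup (positions v) j ≡ just c → c ≤ a → i ⇝ j
positions-arc [] {i} _ eq _ _ with () ← trans (sym (lookup-replicate i nothing)) eq
positions-arc {v = x ∷ v} (x⇝ ∷ v⇝) {i} {j} i≢j ri rj c≤a with i ≟ x | j ≟ x
... | yes refl | yes refl = contradiction refl i≢j
... | yes refl | no j≢x =
  All.lookup x⇝ (proj₁ (positions-just v (trans (sym (lookup∘update′ j≢x (positions v) _)) rj)))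
-- `x` heads the list and holds the top rank `length v`, which the rank of `i` cannot reach.
... | no i≢x | yes refl = contradiction c≤a (<⇒≱ (subst (_ <_)
  (just-injective (trans (sym (lookup∘update x (positions v) (just (length v)))) rj))
  (proj₂ (positions-just v (trans (sym (lookup∘update′ i≢x (positions v) _)) ri)))))
... | no i≢x | no j≢x = positions-arc v⇝ i≢j
  (trans (sym (lookup∘update′ i≢x (positions v) _)) ri)
  (trans (sym (lookup∘update′ j≢x (positions v) _)) rj) c≤a

sequences : ∀ r t → List (List (Fin r))
sequences r t = List.map (λ k → List.tabulate {n = t} (finToFun k)) (allFin (r ^ t))

length-sequences : ∀ r t → length (sequences r t) ≡ r ^ t
length-sequences r t = trans (length-map _ (allFin (r ^ t))) (length-tabulate {n = r ^ t} _)

∈-sequences : ∀ {r} (v : List (Fin r)) → v ∈ sequences r (length v)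
∈-sequences {r} v = subst (_∈ sequences r (length v))
  (trans (tabulate-cong (Fin.finToFun-funToFin (List.lookup v))) (tabulate-lookup v))
  (∈-map⁺ _ (∈-allFin (funToFin (List.lookup v))))

sequences-length : ∀ {r} t {v : List (Fin r)} → v ∈ sequences r t → length v ≡ t
sequences-length t v∈ with ∈-map⁻ _ v∈
... | k , _ , refl = length-tabulate _

totalVolume-const : ∀ {m} p q (E : List (Pattern m)) → (∀ {e} → e ∈ E → volume e * p ≡ q) →
  totalVolume E * p ≡ length E * q
totalVolume-const p q []      _ = refl
totalVolume-const p q (e ∷ E) h = trans (*-distribʳ-+ p (volume e) _)
  (cong₂ _+_ (h (here refl)) (totalVolume-const p q E (h ∘ there)))

TransitiveBelow : ∀ {r} → ℕ → Digraph r → Set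
TransitiveBelow t R = ∀ {v} → AllPairs (λ i j → arc R i j ≡ true) v → length v < t

arcs-unique : ∀ {r} {R : Digraph r} → IsTournament R →
  ∀ {v} → AllPairs (λ i j → arc R i j ≡ true) v → Unique v
arcs-unique {R = R} (irr , _) = AllPairs.map distinct
  where
  distinct : ∀ {i j} → arc R i j ≡ true → i ≢ j
  distinct {i} eq refl with () ← trans (sym (irr i)) eq

-- Union bound over the lists of `t` distinct vertices: there are at most `r ^ t`, and the pattern
-- of each fills one part in `2 ^ pairs t` of the cube. A point outside all patterns is a tournament
-- in which no such list has all its forward arcs.
∃-transitiveBelow : ∀ r t → r ^ t < 2 ^ pairs t →
  Σ (Digraph r) λ R → IsTournament R × TransitiveBelow t R
∃-transitiveBelow r t small = R , tour , below
  where
  S = filter (unique? _≟_) (sequences r t)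
  E = List.map (rankingPattern ∘ positions) S

  volume-E : ∀ {e} → e ∈ E → volume e * 2 ^ pairs t ≡ 2 ^ pairs r
  volume-E e∈ with ∈-map⁻ (rankingPattern ∘ positions) e∈
  ... | v , v∈S , refl with ∈-filter⁻ (unique? _≟_) {xs = sequences r t} v∈S
  ...   | v∈ , v! = subst (λ l → volume (rankingPattern (positions v)) * 2 ^ pairs l ≡ 2 ^ pairs r)
    (trans (ranked-positions v!) (sequences-length t v∈)) (volume-rankingPattern (positions v))

  length-E : length E ≤ r ^ t
  length-E = begin
    length E                 ≡⟨ length-map _ S ⟩
    length S                 ≤⟨ length-filter (unique? _≟_) (sequences r t) ⟩
    length (sequences r t)   ≡⟨ length-sequences r t ⟩
    r ^ t                    ∎
    where open ≤-Reasoning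

  totalVolume-E : totalVolume E < 2 ^ pairs r
  totalVolume-E = *-cancelʳ-< (2 ^ pairs t) _ _ (begin-strict
    totalVolume E * 2 ^ pairs t  ≡⟨ totalVolume-const (2 ^ pairs t) (2 ^ pairs r) E volume-E ⟩
    length E * 2 ^ pairs r       ≤⟨ *-monoˡ-≤ (2 ^ pairs r) length-E ⟩
    r ^ t * 2 ^ pairs r          <⟨ *-monoˡ-< (2 ^ pairs r) {{m^n≢0 2 (pairs r)}} small ⟩
    2 ^ pairs t * 2 ^ pairs r    ≡⟨ *-comm (2 ^ pairs t) _ ⟩
    2 ^ pairs r * 2 ^ pairs t    ∎)
    where open ≤-Reasoning

  solution = union-bound E totalVolume-E
  f = proj₁ solution

  R : Digraph r
  R = record { arc = orient f }

  tour : IsTournament R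
  tour = orient-irrefl f , orient-not f

  not-length-t : ∀ {v} → AllPairs (λ i j → orient f i j ≡ true) v → length v ≢ t
  not-length-t {v} v⇝ v≡t with avoids⇒upset f (positions v) (All.lookup (proj₂ solution)
      (∈-map⁺ (rankingPattern ∘ positions) (∈-filter⁺ (unique? _≟_) (subst (λ l → v ∈ sequences r l) v≡t (∈-sequences v)) (arcs-unique tour v⇝))))
  ... | upset i≢j ri rj c≤a na with () ← trans (sym na) (positions-arc v⇝ i≢j ri rj c≤a)

  below : TransitiveBelow t R
  -- The patterns exclude only length exactly `t`; a longer transitive list is cut to its first `t`
  -- entries.
  below {v} v⇝ = ≰⇒> λ t≤v → not-length-t (AllPairs.take⁺ t v⇝)
    (trans (length-take t v) (m≤n⇒m⊓n≡m t≤v))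

-- Lexicographic powers

Word : ℕ → ℕ → Set
Word r = Vec (Fin r)

module Lexicographic {r : ℕ} (R : Digraph r) (tour : IsTournament R) where

  arcʷ : ∀ {k} → Word r k → Word r k → Bool
  arcʷ []      []      = false
  arcʷ (i ∷ x) (j ∷ y) = if does (i ≟ j) then arcʷ x y else arc R i j

  infix 4 _⇝_
  _⇝_ : ∀ {k} → Word r k → Word r k → Set
  x ⇝ y = arcʷ x y ≡ true

  arcʷ-irrefl : ∀ {k} (x : Word r k) → arcʷ x x ≡ false
  arcʷ-irrefl []      = refl
  arcʷ-irrefl (i ∷ x) rewrite dec-true (i ≟ i) refl = arcʷ-irrefl x

  arcʷ-not : ∀ {k} (x y : Word r k) → x ≢ y → arcʷ x y ≡ not (arcʷ y x)
  arcʷ-not []      []      x≢y = contradiction refl x≢y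
  arcʷ-not (i ∷ x) (j ∷ y) x≢y with i ≟ j | j ≟ i
  ... | yes refl | yes _   = arcʷ-not x y (x≢y ∘ cong (i ∷_))
  ... | yes refl | no j≢i  = contradiction refl j≢i
  ... | no i≢j   | yes j≡i = contradiction (sym j≡i) i≢j
  ... | no i≢j   | no _    = proj₂ tour i j i≢j

  arc-asym : ∀ {i j} → arc R i j ≡ true → arc R j i ≡ true → ⊥
  arc-asym {i} {j} ij ji with i ≟ j
  ... | yes refl with () ← trans (sym (proj₁ tour i)) ij
  ... | no i≢j with () ← trans (sym ij) (trans (proj₂ tour i j i≢j) (cong not ji))

  ⇝-tail : ∀ {k} (x y : Word r (suc k)) → head x ≡ head y → x ⇝ y → tail x ⇝ tail y
  ⇝-tail (i ∷ x) (j ∷ y) refl xy rewrite dec-true (i ≟ i) refl = xy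

  ⇝-head : ∀ {k} (x y : Word r (suc k)) → head x ≢ head y → x ⇝ y → arc R (head x) (head y) ≡ true
  ⇝-head (i ∷ x) (j ∷ y) i≢j xy rewrite dec-false (i ≟ j) i≢j = xy

  -- Otherwise the first letter of `y` would both follow and precede the common letter of `x` and
  -- `z`, a 2-cycle in `R`.
  ⇝-between : ∀ {k} (x y z : Word r (suc k)) → head x ≡ head z → x ⇝ y → y ⇝ z → head y ≡ head x
  ⇝-between x y z x≡z xy yz with head y ≟ head x
  ... | yes y≡x = y≡x
  ... | no y≢x  = ⊥-elim (arc-asym
    (⇝-head x y (y≢x ∘ sym) xy)
    (subst (λ i → arc R (head y) i ≡ true) (sym x≡z) (⇝-head y z (λ y≡z → y≢x (trans y≡z (sym x≡z))) yz)))

-- The gadget digraph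

-- A quad names a gadget by its two base pairs. The Boolean `false` selects the gadget vertex on the
-- first pair, `true` the one on the second.
Quad : ℕ → Set
Quad b = (Fin b × Fin b) × (Fin b × Fin b)

source target : ∀ {b} → Quad b → Bool → Fin b
source ((u , _) , _) false = u
source (_ , (u , _)) true  = u
target ((_ , v) , _) false = v
target (_ , (_ , v)) true  = v

Ordered : ∀ {b} → Quad b → Set
Ordered q = source q false Fin.≤ source q true ×
            source q false Fin.< target q false × source q true Fin.< target q true

ordered? : ∀ {b} (q : Quad b) → Dec (Ordered q)
ordered? q = (_ Fin.≤? _) ×-dec (_ Fin.<? _) ×-dec (_ Fin.<? _)

source<target : ∀ {b} (q : Quad b) → Ordered q → ∀ c → source q c Fin.< target q c
source<target q (_ , lt , _) false = lt
source<target q (_ , _ , lt) true  = lt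

-- The `pad` vertices are isolated and bring the order to exactly `n`. Gadget vertices of quads that
-- are not `Ordered` are isolated too; keeping them makes the count a plain product.
Vertex : ℕ → ℕ → Set
Vertex b p = Fin b ⊎ (Quad b × Bool) ⊎ Fin p

pattern base u  = inj₁ u
pattern mid q c = inj₂ (inj₁ (q , c))
pattern pad i   = inj₂ (inj₂ i)

module _ {b p : ℕ} where

  infix 4 _⟶_ _⟶?_

  data _⟶_ : Vertex b p → Vertex b p → Set where
    enter : ∀ {u q c} → u ≡ source q c → Ordered q → base u ⟶ mid q c
    leave : ∀ {u q c} → u ≡ target q c → Ordered q → mid q c ⟶ base u
    link  : ∀ {q q′} → q ≡ q′ → Ordered q → mid q false ⟶ mid q′ true

  _≟Q_ : (q q′ : Quad b) → Dec (q ≡ q′)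
  _≟Q_ = Product.≡-dec (Product.≡-dec _≟_ _≟_) (Product.≡-dec _≟_ _≟_)

  _⟶?_ : ∀ x y → Dec (x ⟶ y)
  base u      ⟶? mid q c      = map′ (uncurry enter) (λ { (enter e o) → e , o }) ((u ≟ source q c) ×-dec ordered? q)
  mid q c     ⟶? base u       = map′ (uncurry leave) (λ { (leave e o) → e , o }) ((u ≟ target q c) ×-dec ordered? q)
  mid q false ⟶? mid q′ true  = map′ (uncurry link) (λ { (link e o) → e , o }) ((q ≟Q q′) ×-dec ordered? q)
  mid q false ⟶? mid q′ false = no λ ()
  mid q true  ⟶? mid q′ c     = no λ ()
  base u      ⟶? base v       = no λ ()
  base u      ⟶? pad j        = no λ ()
  mid q c     ⟶? pad j        = no λ ()
  pad i       ⟶? y            = no λ ()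

  -- A topological order. The spacing 3 leaves room for both kinds of gadget vertex strictly between
  -- their source and the next base vertex.
  height : Vertex b p → ℕ
  height (base u)      = 3 * toℕ u
  height (mid q false) = 3 * toℕ (source q false) + 1
  height (mid q true)  = 3 * toℕ (source q true) + 2
  height (pad _)       = 0

  ⟶-height : ∀ {x y} → x ⟶ y → height x < height y
  ⟶-height (enter {q = q} {c = false} refl _) = ≤-reflexive (+-comm 1 _)
  ⟶-height (enter {q = q} {c = true} refl _)  = ≤-trans (≤-reflexive (+-comm 1 _)) (+-monoʳ-≤ _ (s≤s z≤n))
  -- Here `u ≤ u′` matters: it gives `3 * u + 1 < 3 * u′ + 2`.
  ⟶-height (link {q = q} refl (u≤u′ , _)) = ≤-trans (≤-reflexive (sym (+-suc _ 1))) (+-monoˡ-≤ 2 (*-monoʳ-≤ 3 u≤u′))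
  ⟶-height (leave {q = q} {c = c} refl o) = ≤-trans (before q c) (≤-trans (≤-reflexive (next (toℕ (source q c)))) (*-monoʳ-≤ 3 (source<target q o c)))
    where
    before : ∀ q c → height (mid q c) < 3 + 3 * toℕ (source q c)
    before q false = ≤-trans (≤-reflexive (+-comm (suc _) 1)) (+-monoˡ-≤ _ {x = 2} {y = 3} (s≤s (s≤s z≤n)))
    before q true  = ≤-reflexive (+-comm (suc _) 2)
    next : ∀ s → 3 + 3 * s ≡ 3 * suc s
    next = solve-∀

  Adjacent : Vertex b p → Vertex b p → Set
  Adjacent x y = x ⟶ y ⊎ y ⟶ x

  mid-neighbour : ∀ {q c x} → Adjacent (mid q c) x →
    x ≡ base (source q c) ⊎ x ≡ base (target q c) ⊎ x ≡ mid q (not c)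
  mid-neighbour (inj₁ (leave refl _)) = inj₂ (inj₁ refl)
  mid-neighbour (inj₁ (link refl _))  = inj₂ (inj₂ refl)
  mid-neighbour (inj₂ (enter refl _)) = inj₁ refl
  mid-neighbour (inj₂ (link refl _))  = inj₂ (inj₂ refl)

∣p∪q∣≤∣p∣+∣q∣ : ∀ {n} (p q : Subset n) → ∣ p ∪ q ∣ ≤ ∣ p ∣ + ∣ q ∣
∣p∪q∣≤∣p∣+∣q∣ []            []            = z≤n
∣p∪q∣≤∣p∣+∣q∣ (outside ∷ p) (outside ∷ q) = ∣p∪q∣≤∣p∣+∣q∣ p q
∣p∪q∣≤∣p∣+∣q∣ (outside ∷ p) (inside ∷ q)  = ≤-trans (s≤s (∣p∪q∣≤∣p∣+∣q∣ p q)) (≤-reflexive (sym (+-suc _ _)))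
∣p∪q∣≤∣p∣+∣q∣ (inside ∷ p)  (outside ∷ q) = s≤s (∣p∪q∣≤∣p∣+∣q∣ p q)
∣p∪q∣≤∣p∣+∣q∣ (inside ∷ p)  (inside ∷ q)  = s≤s (≤-trans (∣p∪q∣≤∣p∣+∣q∣ p q) (+-monoʳ-≤ _ (n≤1+n _)))

∣p∣≤3 : ∀ {n} {p : Subset n} (a b c : Fin n) → (∀ {x} → x ∈ₛ p → x ≡ a ⊎ x ≡ b ⊎ x ≡ c) → ∣ p ∣ ≤ 3
∣p∣≤3 {p = p} a b c cover = begin
  ∣ p ∣                                  ≤⟨ p⊆q⇒∣p∣≤∣q∣ p⊆ ⟩
  ∣ ⁅ a ⁆ ∪ (⁅ b ⁆ ∪ ⁅ c ⁆) ∣            ≤⟨ ∣p∪q∣≤∣p∣+∣q∣ ⁅ a ⁆ _ ⟩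
  ∣ ⁅ a ⁆ ∣ + ∣ ⁅ b ⁆ ∪ ⁅ c ⁆ ∣          ≤⟨ +-monoʳ-≤ ∣ ⁅ a ⁆ ∣ (∣p∪q∣≤∣p∣+∣q∣ ⁅ b ⁆ ⁅ c ⁆) ⟩
  ∣ ⁅ a ⁆ ∣ + (∣ ⁅ b ⁆ ∣ + ∣ ⁅ c ⁆ ∣)    ≡⟨ cong₂ _+_ (∣⁅x⁆∣≡1 a) (cong₂ _+_ (∣⁅x⁆∣≡1 b) (∣⁅x⁆∣≡1 c)) ⟩
  3                                      ∎
  where
  open ≤-Reasoning
  p⊆ : ∀ {x} → x ∈ₛ p → x ∈ₛ ⁅ a ⁆ ∪ (⁅ b ⁆ ∪ ⁅ c ⁆)
  p⊆ x∈p with cover x∈p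
  ... | inj₁ refl        = x∈p∪q⁺ (inj₁ (x∈⁅x⁆ a))
  ... | inj₂ (inj₁ refl) = x∈p∪q⁺ {p = ⁅ a ⁆} (inj₂ (x∈p∪q⁺ (inj₁ (x∈⁅x⁆ b))))
  ... | inj₂ (inj₂ refl) = x∈p∪q⁺ {p = ⁅ a ⁆} (inj₂ (x∈p∪q⁺ {p = ⁅ b ⁆} (inj₂ (x∈⁅x⁆ c))))

does-true : ∀ {A : Set} (a? : Dec A) → does a? ≡ true → A
does-true (yes a) _ = a

module Gadgets {b p n : ℕ} (enum : Fin n ↔ Vertex b p) where
  open Inverse enum using (to; from; strictlyInverseˡ; strictlyInverseʳ)

  D : Digraph n
  D = record { arc = λ i j → does (to i ⟶? to j) }

  arc⇒⟶ : ∀ {i j} → arc D i j ≡ true → to i ⟶ to j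
  arc⇒⟶ {i} {j} = does-true (to i ⟶? to j)

  ⟶⇒arc : ∀ {x y} → x ⟶ y → arc D (from x) (from y) ≡ true
  ⟶⇒arc {x} {y} xy = dec-true (to (from x) ⟶? to (from y))
    (subst₂ _⟶_ (sym (strictlyInverseˡ x)) (sym (strictlyInverseˡ y)) xy)

  path-height : ∀ {i j} → Path D i j → height (to i) < height (to j)
  path-height (edge ij)    = ⟶-height (arc⇒⟶ ij)
  path-height (step ij jk) = <-trans (⟶-height (arc⇒⟶ ij)) (path-height jk)

  acyclic : Acyclic D
  acyclic i = <-irrefl refl ∘ path-height

  uadj⇒⟶ : ∀ i j → uadj D i j ≡ true → Adjacent (to i) (to j)
  uadj⇒⟶ i j adj with arc D i j in ij
  ... | true  = inj₁ (arc⇒⟶ ij)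
  ... | false = inj₂ (arc⇒⟶ adj)

  ∈-nbhd : ∀ {i j x} → to i ≡ x → j ∈ₛ nbhd D i → Adjacent x (to j)
  ∈-nbhd {i} {j} refl j∈ with uadj⇒⟶ j i (trans (sym (lookup∘tabulate (λ u → uadj D u i) j)) ([]=⇒lookup j∈))
  ... | inj₁ ji = inj₂ ji
  ... | inj₂ ij = inj₁ ij

  to≡⇒≡from : ∀ {i x} → to i ≡ x → i ≡ from x
  to≡⇒≡from {i} refl = sym (strictlyInverseʳ i)

  NotBase : Vertex b p → Set
  NotBase x = ∀ u → x ≢ base u

  notBase? : ∀ x → Dec (NotBase x)
  notBase? (base u) = no λ nb → nb u refl
  notBase? (inj₂ _) = yes λ _ ()

  ∣S∩nbhd∣≤3 : ∀ S i x → to i ≡ x → NotBase x → ∣ S ∩ nbhd D i ∣ ≤ 3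
  ∣S∩nbhd∣≤3 S i (base u)  eq nb = contradiction refl (nb u)
  ∣S∩nbhd∣≤3 S i (mid q c) eq _  = ∣p∣≤3 (from (base (source q c))) (from (base (target q c))) (from (mid q (not c))) cover
    where
    cover : ∀ {j} → j ∈ₛ S ∩ nbhd D i → _
    cover j∈ with mid-neighbour (∈-nbhd eq (proj₂ (x∈p∩q⁻ S (nbhd D i) j∈)))
    ... | inj₁ e        = inj₁ (to≡⇒≡from e)
    ... | inj₂ (inj₁ e) = inj₂ (inj₁ (to≡⇒≡from e))
    ... | inj₂ (inj₂ e) = inj₂ (inj₂ (to≡⇒≡from e))
  ∣S∩nbhd∣≤3 S i (pad _)   eq _  = ∣p∣≤3 i i i λ j∈ → ⊥-elim
    (isolated (∈-nbhd eq (proj₂ (x∈p∩q⁻ S (nbhd D i) j∈))))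
    where
    isolated : ∀ {k x} → ¬ Adjacent (pad k) x
    isolated (inj₁ ())
    isolated (inj₂ ())

  -- Any vertex of `S` outside the base has total degree at most 3. If there is none, `S` consists
  -- of base vertices, and these are pairwise non-adjacent.
  threeDegenerate : ThreeDegenerate D
  threeDegenerate S (i , i∈S) with Fin.any? (λ v → (v ∈? S) ×-dec notBase? (to v))
  ... | yes (v , v∈S , nb) = v , v∈S , ∣S∩nbhd∣≤3 S v (to v) refl nb
  ... | no onlyBase = i , i∈S , ∣p∣≤3 i i i λ {j} j∈ → ⊥-elim
    (let j∈S , j∈N = x∈p∩q⁻ S (nbhd D i) j∈ in independent (∈-nbhd refl j∈N) (isBase i∈S) (isBase j∈S))
    where
    isBase : ∀ {v} → v ∈ₛ S → ¬ NotBase (to v)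
    isBase v∈S nb = onlyBase (_ , v∈S , nb)
    independent : ∀ {x y} → Adjacent x y → ¬ NotBase x → ¬ ¬ NotBase y
    independent (inj₁ (enter _ _)) _ bb = bb λ _ ()
    independent (inj₁ (leave _ _)) aa _ = aa λ _ ()
    independent (inj₁ (link _ _)) aa _  = aa λ _ ()
    independent (inj₂ (enter _ _)) aa _ = aa λ _ ()
    independent (inj₂ (leave _ _)) _ bb = bb λ _ ()
    independent (inj₂ (link _ _)) aa _  = aa λ _ ()

-- Colour classes of a copy

module Classes {b r m : ℕ} (h : Fin b → Fin r) (_↝_ : Fin r → Fin r → Set) where

  Compatible : List (Fin b) → Set
  Compatible A = ∀ {u v u′ v′} → u ∈ A → v ∈ A → u′ ∈ A → v′ ∈ A →
    u Fin.< v → u′ Fin.< v′ → u Fin.≤ u′ → h u ≡ h v → h u′ ≡ h v′ → h u ≢ h u′ → h u ↝ h u′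

  SmallClasses : List (Fin b) → Set
  SmallClasses A = ∀ {C} i → AllPairs Fin._<_ C → (∀ {u} → u ∈ C → u ∈ A × h u ≡ i) → length C ≤ m

  Single Repeated : List (Fin b) → Fin r → Set
  Single   A s = ∃[ u ] u ∈ A × h u ≡ s
  Repeated A g = ∃[ u ] ∃[ v ] u ∈ A × v ∈ A × u Fin.< v × h u ≡ g × h v ≡ g

  -- `singles` is for the letters used once, each accounting for one element; `chain` is for those
  -- used at least twice, by first occurrence, each accounting for at most `m` elements.
  record Decomposition (A : List (Fin b)) : Set where
    field
      singles chain : List (Fin r)
      singles-unique : Unique singles
      singles-occur  : All (Single A) singles
      chain-sorted   : AllPairs _↝_ chain
      chain-occurs   : All (Repeated A) chain
      length-bound   : length A ≤ length singles + length chain * m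

  length-filter-split : ∀ i A → length (filter (λ u → h u ≟ i) A) + length (filter (λ u → ¬? (h u ≟ i)) A) ≡ length A
  length-filter-split i [] = refl
  length-filter-split i (u ∷ A) with h u ≟ i
  ... | yes _ = cong suc (length-filter-split i A)
  ... | no  _ = trans (+-suc _ _) (cong suc (length-filter-split i A))

  -- Remove the class of the first element and recurse on the rest `B`. As `B` is a filtered list,
  -- the bound `l` on its length makes the recursion structural.
  decompose : ∀ l A → length A ≤ l → AllPairs Fin._<_ A → Compatible A → SmallClasses A → Decomposition A
  decompose l [] _ _ _ _ = record
    { singles = [] ; chain = [] ; singles-unique = [] ; singles-occur = []
    ; chain-sorted = [] ; chain-occurs = [] ; length-bound = z≤n }
  decompose (suc l) (u ∷ A) (s≤s A≤l) (u< ∷ A<) compatible small = addClass C C⊆ C< length-A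
    where
    same? = λ v → h v ≟ h u
    other? = λ v → ¬? (h v ≟ h u)
    B = filter other? A
    C = filter same? A

    B⊆ : ∀ {v} → v ∈ B → v ∈ A × h v ≢ h u
    B⊆ = ∈-filter⁻ other?

    C⊆ : ∀ {v} → v ∈ C → v ∈ A × h v ≡ h u
    C⊆ = ∈-filter⁻ same?

    C< : AllPairs Fin._<_ C
    C< = AllPairs.filter⁺ same? A<

    length-A : length A ≡ length C + length B
    length-A = sym (length-filter-split (h u) A)

    B-in : ∀ {v} → v ∈ B → v ∈ u ∷ A
    B-in = there ∘ proj₁ ∘ B⊆

    B≤A : length B ≤ length A
    B≤A = subst (length B ≤_) (sym length-A) (m≤n+m (length B) (length C))

    rest : Decomposition B
    rest = decompose l B (≤-trans B≤A A≤l) (AllPairs.filter⁺ other? A<)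
      (λ p q p′ q′ → compatible (B-in p) (B-in q) (B-in p′) (B-in q′))
      (λ i S< S⊆ → small i S< λ v∈ → B-in (proj₁ (S⊆ v∈)) , proj₂ (S⊆ v∈))

    open Decomposition rest

    single-in : ∀ {s} → Single B s → Single (u ∷ A) s
    single-in (v , v∈ , e) = v , B-in v∈ , e

    repeated-in : ∀ {g} → Repeated B g → Repeated (u ∷ A) g
    repeated-in (v , w , v∈ , w∈ , rest) = v , w , B-in v∈ , B-in w∈ , rest

    -- The class becomes a variable so that it can be matched on. It omits `u` itself, so the empty
    -- case means that no other element has the letter of `u`.
    addClass : ∀ C → (∀ {v} → v ∈ C → v ∈ A × h v ≡ h u) → AllPairs Fin._<_ C →
      length A ≡ length C + length B → Decomposition (u ∷ A)
    addClass [] _ _ A≡B = record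
      { singles        = h u ∷ singles
      ; chain          = chain
      ; singles-unique = All.map (λ { (v , v∈ , e) hu≡s → proj₂ (B⊆ v∈) (trans e (sym hu≡s)) }) singles-occur ∷ singles-unique
      ; singles-occur  = (u , here refl , refl) ∷ All.map single-in singles-occur
      ; chain-sorted   = chain-sorted
      ; chain-occurs   = All.map repeated-in chain-occurs
      ; length-bound   = s≤s (subst (_≤ length singles + length chain * m) (sym A≡B) length-bound)
      }
    addClass C@(v ∷ _) C⊆ C< A≡C+B = record
      { singles        = singles
      ; chain          = h u ∷ chain
      ; singles-unique = singles-unique
      ; singles-occur  = All.map single-in singles-occur
      ; chain-sorted   = All.map precedes chain-occurs ∷ chain-sorted
      ; chain-occurs   = (u , v , here refl , v∈ , u<v , refl , v~u) ∷ All.map repeated-in chain-occurs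
      ; length-bound   = begin
          suc (length A)                              ≡⟨ cong suc A≡C+B ⟩
          suc (length C) + length B                   ≤⟨ +-mono-≤ class length-bound ⟩
          m + (length singles + length chain * m)     ≡⟨ +-comm m _ ⟩
          length singles + length chain * m + m       ≡⟨ +-assoc (length singles) _ m ⟩
          length singles + (length chain * m + m)     ≡⟨ cong (length singles +_) (+-comm _ m) ⟩
          length singles + suc (length chain) * m     ∎
      }
      where
      open ≤-Reasoning
      v∈ : v ∈ u ∷ A
      v∈ = there (proj₁ (C⊆ (here refl)))
      v~u : h v ≡ h u
      v~u = proj₂ (C⊆ (here refl))
      u<v : u Fin.< v
      u<v = All.lookup u< (proj₁ (C⊆ (here refl)))
      class : suc (length C) ≤ m
      class = small (h u) (All.tabulate (All.lookup u< ∘ proj₁ ∘ C⊆) ∷ C<)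
        λ { (here refl) → here refl , refl ; (there w∈) → there (proj₁ (C⊆ w∈)) , proj₂ (C⊆ w∈) }
      -- Every element of `B` comes after `u`, so the gadget on the pair `u`, `v` and a later pair
      -- directs the letter of `u` to `g`.
      precedes : ∀ {g} → Repeated B g → h u ↝ g
      precedes (x , y , x∈ , y∈ , x<y , refl , hy) = compatible (here refl) v∈ (B-in x∈) (B-in y∈) u<v x<y
        (<⇒≤ (All.lookup u< (proj₁ (B⊆ x∈)))) (sym v~u) (sym hy) (λ e → proj₂ (B⊆ x∈) (sym e))

-- Base sizes that fit into a lexicographic power

ranked≤ : ∀ {r} (xs : Ranking r) → ranked xs ≤ r
ranked≤ []             = z≤n
ranked≤ (just _ ∷ xs)  = s≤s (ranked≤ xs)
ranked≤ (nothing ∷ xs) = m≤n⇒m≤1+n (ranked≤ xs)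

-- Pigeonhole: `positions v` ranks `length v` of the `r` vertices.
unique-length : ∀ {r} {v : List (Fin r)} → Unique v → length v ≤ r
unique-length {r} {v} v! = subst (_≤ r) (ranked-positions v!) (ranked≤ (positions v))

-- Bounds the base in the `k`-th power: at most `r` letters are used once, and at most `t` are
-- repeated, each with a class that lives in the next lower power.
capacity : ℕ → ℕ → ℕ → ℕ
capacity r t zero    = 1
capacity r t (suc k) = r + t * capacity r t k

module Embedding {b p r t : ℕ} (R : Digraph r) (tour : IsTournament R) (below : TransitiveBelow (suc t) R) where
  open Lexicographic R tour

  -- The part of the digraph spanned by `A`. Both vertices of a gadget carry the condition on all
  -- four ends, so they belong to the part together.
  Over : List (Fin b) → Vertex b p → Set
  Over A (base u)  = u ∈ A
  Over A (mid q _) = ∀ c → source q c ∈ A × target q c ∈ A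
  Over A (pad _)   = ⊥

  Preserves : ∀ {k} → List (Fin b) → (Vertex b p → Word r k) → Set
  Preserves A f = ∀ {x y} → Over A x → Over A y → x ⟶ y → f x ⇝ f y

  module _ {k} {A} (f : Vertex b p → Word r (suc k)) (pres : Preserves A f) where

    colour : Fin b → Fin r
    colour u = head (f (base u))

    mid-colour : ∀ {q c} → Ordered q → Over A (mid q c) → colour (source q c) ≡ colour (target q c) →
      head (f (mid q c)) ≡ colour (source q c)
    mid-colour {q} {c} o over same = ⇝-between (f (base (source q c))) (f (mid q c)) (f (base (target q c))) same
      (pres (proj₁ (over c)) over (enter refl o)) (pres over (proj₂ (over c)) (leave refl o))

    linked-classes : ∀ {q} → Ordered q → (∀ c → source q c ∈ A × target q c ∈ A) →
      (∀ c → colour (source q c) ≡ colour (target q c)) →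
      colour (source q false) ≢ colour (source q true) →
      arc R (colour (source q false)) (colour (source q true)) ≡ true
    linked-classes {q} o over same differ = subst₂ (λ i j → arc R i j ≡ true) x≡ y≡
      (⇝-head (f (mid q false)) (f (mid q true))
        (λ e → differ (trans (sym x≡) (trans e y≡))) (pres over over (link refl o)))
      where
      x≡ = mid-colour {c = false} o over (same false)
      y≡ = mid-colour {c = true} o over (same true)

    -- By `mid-colour`, the gadget vertices over a one-letter class share its letter, so the
    -- remaining letters decide the arcs there.
    preserves-tail : ∀ {C} i → (∀ {u} → u ∈ C → u ∈ A × colour u ≡ i) → Preserves C (tail ∘ f)
    preserves-tail {C} i C⊆ {x} {y} ox oy xy = ⇝-tail (f x) (f y)
      (trans (colour-i x ox (proj₁ (ends-ordered xy))) (sym (colour-i y oy (proj₂ (ends-ordered xy)))))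
      (pres (over-A x ox) (over-A y oy) xy)
      where
      over-A : ∀ x → Over C x → Over A x
      over-A (base u)  u∈   = proj₁ (C⊆ u∈)
      over-A (mid q _) over = λ c → proj₁ (C⊆ (proj₁ (over c))) , proj₁ (C⊆ (proj₂ (over c)))

      -- A gadget vertex of a quad that is not `Ordered` has an uncontrolled first letter. It is an
      -- end of no arc, so the order is read off from the arc at hand.
      OrderedMid : Vertex b p → Set
      OrderedMid x = ∀ {q c} → x ≡ mid q c → Ordered q

      ends-ordered : ∀ {x y} → x ⟶ y → OrderedMid x × OrderedMid y
      ends-ordered (enter _ o)   = (λ ()) , λ { refl → o }
      ends-ordered (leave _ o)   = (λ { refl → o }) , λ ()
      ends-ordered (link refl o) = (λ { refl → o }) , λ { refl → o }

      colour-i : ∀ x → Over C x → OrderedMid x → head (f x) ≡ i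
      colour-i (base u)  u∈   _ = proj₂ (C⊆ u∈)
      colour-i (mid q c) over o = trans
        (mid-colour (o refl) (over-A (mid q c) over) (trans (source-i c) (sym (proj₂ (C⊆ (proj₂ (over c)))))))
        (source-i c)
        where
        source-i = λ c → proj₂ (C⊆ (proj₁ (over c)))

  length≤capacity : ∀ k {A} → AllPairs Fin._<_ A → (f : Vertex b p → Word r k) → Preserves A f →
    length A ≤ capacity r t k
  length≤capacity zero {[]}     _ _ _ = z≤n
  length≤capacity zero {_ ∷ []} _ _ _ = s≤s z≤n
  -- Two base vertices already span a gadget with both pairs equal to `(u , v)`, while the power on
  -- the single empty word has no arcs.
  length≤capacity zero {u ∷ v ∷ _} ((u<v ∷ _) ∷ _) f pres =
    ⊥-elim (¬⇝ (f (base u)) (f (mid q false)) (pres (here refl) over (enter refl (≤-refl , u<v , u<v))))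
    where
    q : Quad b
    q = (u , v) , (u , v)
    over : Over (u ∷ v ∷ _) (mid q false)
    over false = here refl , there (here refl)
    over true  = here refl , there (here refl)
    ¬⇝ : (x y : Word r 0) → ¬ x ⇝ y
    ¬⇝ [] [] ()
  length≤capacity (suc k) {A} A< f pres = begin
    length A                                            ≤⟨ length-bound ⟩
    -- `below` bounds the chain strictly by `suc t`, hence by `t`.
    length singles + length chain * capacity r t k      ≤⟨ +-mono-≤ (unique-length singles-unique)
                                                             (*-monoˡ-≤ (capacity r t k) (m<1+n⇒m≤n (below chain-sorted))) ⟩
    r + t * capacity r t k                              ∎
    where
    open ≤-Reasoning
    open Classes {m = capacity r t k} (colour f pres) (λ i j → arc R i j ≡ true)

    compatible : Compatible A
    compatible {u} {v} {u′} {v′} u∈ v∈ u′∈ v′∈ u<v u′<v′ u≤u′ same same′ differ =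
      linked-classes f pres {q = (u , v) , (u′ , v′)} (u≤u′ , u<v , u′<v′)
        (λ { false → u∈ , v∈ ; true → u′∈ , v′∈ }) (λ { false → same ; true → same′ }) differ

    open Decomposition (decompose _ A ≤-refl A< compatible
      λ i C< C⊆ → length≤capacity k C< (tail ∘ f) (preserves-tail f pres i C⊆))

  no-copy : ∀ k → capacity r t k < b → (f : Vertex b p → Word r k) → ¬ (∀ {x y} → x ⟶ y → f x ⇝ f y)
  no-copy k small f pres = <⇒≱ small (subst (_≤ capacity r t k) (length-tabulate {n = b} _)
    (length≤capacity k (AllPairs.tabulate⁺-< λ i<j → i<j) f λ _ _ → pres))

-- Choice of parameters

∃word-injection : ∀ {N} r k → N ≤ r ^ k → ∃ λ (ι : Fin N → Word r k) → Injective _≡_ _≡_ ι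
∃word-injection {N} r k N≤ = ι , injective
  where
  code : Fin N → Fin k → Fin r
  code i = finToFun (Fin.inject≤ i N≤)
  ι : Fin N → Word r k
  ι = tabulate ∘ code
  funToFin-cong : ∀ {m n} {f g : Fin m → Fin n} → (∀ i → f i ≡ g i) → funToFin f ≡ funToFin g
  funToFin-cong {zero}  _  = refl
  funToFin-cong {suc m} fg = cong₂ Fin.combine (fg zero) (funToFin-cong (fg ∘ suc))
  injective : Injective _≡_ _≡_ ι
  injective {i} {j} eq = Fin.inject≤-injective N≤ N≤ i j (begin
    Fin.inject≤ i N≤           ≡⟨ Fin.funToFin-finToFin {k} {r} _ ⟨
    funToFin (code i)      ≡⟨ funToFin-cong {k} (λ l → trans (sym (lookup∘tabulate (code i) l))
                                    (trans (cong (λ w → lookup w l) eq) (lookup∘tabulate (code j) l))) ⟩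
    funToFin (code j)      ≡⟨ Fin.funToFin-finToFin {k} {r} _ ⟩
    Fin.inject≤ j N≤           ∎)
    where open ≡-Reasoning

enumeration : ∀ b p → Fin (b + ((b * b) * (b * b) * 2 + p)) ↔ Vertex b p
enumeration b p = ↔-trans Fin.+↔⊎ (↔-refl ⊎-↔ ↔-trans Fin.+↔⊎ (quads ⊎-↔ ↔-refl))
  where
  quads = ↔-trans Fin.*↔× (↔-trans Fin.*↔× (Fin.*↔× ×-↔ Fin.*↔×) ×-↔ Fin.2↔Bool)

-- If `N ≤ r ^ k`, the `k`-th power of `R` has a subtournament on `N` words, and `no-copy` forbids
-- `D` in it.
ramsey-lower-bound : ∀ {n r t b} k → r ^ suc t < 2 ^ pairs (suc t) → capacity r t k < b →
  b + (b * b) * (b * b) * 2 ≤ n →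
  Σ (Digraph n) λ D → Acyclic D × ThreeDegenerate D × (∀ N → AllTournamentsContain N D → r ^ k < N)
ramsey-lower-bound {n} {r} {t} {b} k ramsey small fits with m≤n⇒∃[o]m+o≡n fits
... | p , refl with ∃-transitiveBelow r (suc t) ramsey
... | R , tour , below = D , acyclic , threeDegenerate , bound
  where
  enum : Fin (b + (b * b) * (b * b) * 2 + p) ↔ Vertex b p
  enum = subst (λ m → Fin m ↔ Vertex b p) (sym (+-assoc b _ p)) (enumeration b p)
  open Gadgets enum
  open Lexicographic R tour
  bound : ∀ N → AllTournamentsContain N D → r ^ k < N
  bound N contain = ≰⇒> λ N≤ →
    let ι , inj = ∃word-injection r k N≤
        T : Digraph N
        T = record { arc = λ i j → arcʷ (ι i) (ι j) }
        f , _ , hom = contain T ((arcʷ-irrefl ∘ ι) , λ i j i≢j → arcʷ-not (ι i) (ι j) (i≢j ∘ inj))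
    in Embedding.no-copy R tour below k small (ι ∘ f ∘ Inverse.from enum) (λ xy → hom _ _ (⟶⇒arc xy))

-- The factor `suc r` makes the bound `c` for `k` at least `r`, so the added `r` is absorbed:
-- `r + t * c ≤ suc t * c`.
capacity≤ : ∀ r t k → capacity r t k ≤ suc r * suc t ^ k
capacity≤ r t zero    = s≤s z≤n
capacity≤ r t (suc k) = begin
  r + t * capacity r t k        ≤⟨ +-mono-≤ r≤ (*-monoʳ-≤ t (capacity≤ r t k)) ⟩
  c + t * c                     ≡⟨⟩
  suc t * (suc r * suc t ^ k)   ≡⟨ swap (suc t) (suc r) (suc t ^ k) ⟩
  suc r * (suc t * suc t ^ k)   ∎
  where
  open ≤-Reasoning
  c = suc r * suc t ^ k
  r≤ : r ≤ c
  r≤ = ≤-trans (n≤1+n r) (m≤m*n (suc r) (suc t ^ k) {{m^n≢0 (suc t) k}})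
  swap : ∀ x y z → x * (y * z) ≡ y * (x * z)
  swap = solve-∀

pairs*2 : ∀ s → pairs (suc s) * 2 ≡ suc s * s
pairs*2 zero    = refl
pairs*2 (suc s) = begin
  (suc s + pairs (suc s)) * 2      ≡⟨ *-distribʳ-+ 2 (suc s) _ ⟩
  suc s * 2 + pairs (suc s) * 2    ≡⟨ cong (suc s * 2 +_) (pairs*2 s) ⟩
  suc s * 2 + suc s * s            ≡⟨ regroup s ⟩
  suc (suc s) * suc s              ∎
  where
  open ≡-Reasoning
  regroup : ∀ s → suc s * 2 + suc s * s ≡ suc (suc s) * suc s
  regroup = solve-∀

-- The hypothesis of the union bound for `r = 2 ^ ρ`. As `pairs (2 + 2 * ρ)` equals
-- `(1 + ρ) * (1 + 2 * ρ)`, it exceeds `ρ * (2 + 2 * ρ)` by `1 + ρ`.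
2^m^n<2^pairs : ∀ ρ → (2 ^ ρ) ^ (2 + 2 * ρ) < 2 ^ pairs (2 + 2 * ρ)
2^m^n<2^pairs ρ = begin-strict
  (2 ^ ρ) ^ (2 + 2 * ρ)     ≡⟨ ^-*-assoc 2 ρ (2 + 2 * ρ) ⟩
  2 ^ (ρ * (2 + 2 * ρ))     <⟨ ^-monoʳ-< 2 (s≤s (s≤s z≤n)) exponents ⟩
  2 ^ pairs (2 + 2 * ρ)     ∎
  where
  open ≤-Reasoning
  regroup : ∀ ρ → (2 + 2 * ρ) * (1 + 2 * ρ) ≡ ρ * (2 + 2 * ρ) * 2 + suc (suc (2 * ρ))
  regroup = solve-∀
  exponents : ρ * (2 + 2 * ρ) < pairs (2 + 2 * ρ)
  exponents = *-cancelʳ-< 2 _ _ (begin-strict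
    ρ * (2 + 2 * ρ) * 2                           <⟨ m<m+n _ (s≤s z≤n) ⟩
    ρ * (2 + 2 * ρ) * 2 + suc (suc (2 * ρ))       ≡⟨ regroup ρ ⟨
    (2 + 2 * ρ) * (1 + 2 * ρ)                     ≡⟨ pairs*2 (suc (2 * ρ)) ⟨
    pairs (2 + 2 * ρ) * 2                         ∎)

suc[2^n]≤2^[1+n] : ∀ n → suc (2 ^ n) ≤ 2 ^ suc n
suc[2^n]≤2^[1+n] n = begin
  1 + 2 ^ n            ≤⟨ +-monoˡ-≤ (2 ^ n) (m^n>0 2 n) ⟩
  2 ^ n + 2 ^ n        ≡⟨ cong (2 ^ n +_) (+-identityʳ (2 ^ n)) ⟨
  2 ^ suc n            ∎
  where open ≤-Reasoning

-- Of the exponent `3 * ρ`, the factor `suc r` uses at most `1 + ρ` and the power `(2 + 2 * ρ) ^ k`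
-- at most `e * k ≤ ρ`; `2 ≤ ρ` makes the inequality strict.
capacity<2^3ρ : ∀ {ρ e k} → 2 ≤ ρ → 2 + 2 * ρ ≤ 2 ^ e → k * e ≤ ρ →
  capacity (2 ^ ρ) (1 + 2 * ρ) k < 2 ^ (3 * ρ)
capacity<2^3ρ {ρ} {e} {k} 2≤ρ t≤ ke≤ρ = begin-strict
  capacity (2 ^ ρ) (1 + 2 * ρ) k       ≤⟨ capacity≤ (2 ^ ρ) (1 + 2 * ρ) k ⟩
  suc (2 ^ ρ) * (2 + 2 * ρ) ^ k        ≤⟨ *-mono-≤ (suc[2^n]≤2^[1+n] ρ) (^-monoˡ-≤ k t≤) ⟩
  2 ^ suc ρ * (2 ^ e) ^ k              ≡⟨ cong (2 ^ suc ρ *_) (^-*-assoc 2 e k) ⟩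
  2 ^ suc ρ * 2 ^ (e * k)              ≡⟨ ^-distribˡ-+-* 2 (suc ρ) (e * k) ⟨
  2 ^ (suc ρ + e * k)                  <⟨ ^-monoʳ-< 2 (s≤s (s≤s z≤n)) exponents ⟩
  2 ^ (3 * ρ)                          ∎
  where
  open ≤-Reasoning
  regroup : ∀ ρ → 2 + ρ + ρ ≡ 2 + 2 * ρ
  regroup = solve-∀
  exponents : suc ρ + e * k < 3 * ρ
  exponents = begin-strict
    suc ρ + e * k   ≡⟨ cong (suc ρ +_) (*-comm e k) ⟩
    suc ρ + k * e   ≤⟨ +-monoʳ-≤ (suc ρ) ke≤ρ ⟩
    suc ρ + ρ       <⟨ ≤-refl ⟩
    2 + ρ + ρ       ≡⟨ regroup ρ ⟩
    2 + 2 * ρ       ≤⟨ +-monoˡ-≤ (2 * ρ) 2≤ρ ⟩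
    3 * ρ           ∎

gadgets-fit : ∀ β → 2 ^ β + (2 ^ β * 2 ^ β) * (2 ^ β * 2 ^ β) * 2 ≤ 2 ^ (4 * β + 2)
gadgets-fit β = begin
  b + (b * b) * (b * b) * 2                       ≤⟨ +-monoˡ-≤ _ b≤ ⟩
  (b * b) * (b * b) * 2 + (b * b) * (b * b) * 2   ≡⟨ regroup b ⟩
  b ^ 4 * 4                                       ≡⟨ cong (_* 4) (^-*-assoc 2 β 4) ⟩
  2 ^ (β * 4) * 2 ^ 2                             ≡⟨ ^-distribˡ-+-* 2 (β * 4) 2 ⟨
  2 ^ (β * 4 + 2)                                 ≡⟨ cong (λ e → 2 ^ (e + 2)) (*-comm β 4) ⟩
  2 ^ (4 * β + 2)                                 ∎
  where
  open ≤-Reasoning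
  b = 2 ^ β
  instance
    b≢0 : NonZero b
    b≢0 = m^n≢0 2 β
    b²≢0 : NonZero (b * b)
    b²≢0 = m*n≢0 b b
  b≤ : b ≤ (b * b) * (b * b) * 2
  b≤ = ≤-trans (m≤m*n b b) (≤-trans (m≤m*n (b * b) (b * b)) (m≤m*n _ 2))
  regroup : ∀ b → (b * b) * (b * b) * 2 + (b * b) * (b * b) * 2 ≡ b * (b * (b * (b * 1))) * 4
  regroup = solve-∀

-- Binary logarithms and rounding

2^⌊log₂n⌋≤n : ∀ n .{{_ : NonZero n}} → 2 ^ ⌊log₂ n ⌋ ≤ n
2^⌊log₂n⌋≤n n = go n (<-wellFounded n)
  where
  open ≤-Reasoning
  double : ∀ n → 2 * ⌊ n /2⌋ ≤ n
  double n = begin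
    2 * ⌊ n /2⌋                ≡⟨ cong (⌊ n /2⌋ +_) (+-identityʳ _) ⟩
    ⌊ n /2⌋ + ⌊ n /2⌋          ≤⟨ +-monoʳ-≤ ⌊ n /2⌋ (⌊n/2⌋≤⌈n/2⌉ n) ⟩
    ⌊ n /2⌋ + ⌊ suc n /2⌋      ≡⟨ ⌊n/2⌋+⌈n/2⌉≡n n ⟩
    n                          ∎
  -- Recursion on the accessibility argument of `⌊log2⌋` lets its defining equations unfold by
  -- computation.
  go : ∀ n (a : Acc _<_ n) .{{_ : NonZero n}} → 2 ^ ⌊log2⌋ n a ≤ n
  go 1             _        = s≤s z≤n
  go (suc (suc n)) (acc rs) = ≤-trans (*-monoʳ-≤ 2 (go (suc ⌊ n /2⌋) _)) (double (suc (suc n)))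

2^m≤n⇒m≤⌊log₂n⌋ : ∀ m {n} → 2 ^ m ≤ n → m ≤ ⌊log₂ n ⌋
2^m≤n⇒m≤⌊log₂n⌋ m le = subst (_≤ _) (⌊log₂[2^n]⌋≡n m) (⌊log₂⌋-mono-≤ le)

n<2^[1+⌊log₂n⌋] : ∀ n → n < 2 ^ suc ⌊log₂ n ⌋
n<2^[1+⌊log₂n⌋] n = ≰⇒> λ le → <-irrefl refl (2^m≤n⇒m≤⌊log₂n⌋ (suc ⌊log₂ n ⌋) le)

m<[1+m/n]*n : ∀ m n .{{_ : NonZero n}} → m < suc (m / n) * n
m<[1+m/n]*n m n = begin-strict
  m                    ≡⟨ m≡m%n+[m/n]*n m n ⟩
  m % n + m / n * n    <⟨ +-monoˡ-< (m / n * n) (m%n<n m n) ⟩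
  suc (m / n) * n      ∎
  where open ≤-Reasoning

suc≤2* : ∀ {m} → 1 ≤ m → suc m ≤ 2 * m
suc≤2* {m} 1≤m = ≤-trans (+-monoˡ-≤ m 1≤m) (≤-reflexive (cong (m +_) (sym (+-identityʳ m))))

16*[8+m]≤2^[7+m] : ∀ m → 16 * (8 + m) ≤ 2 ^ (7 + m)
16*[8+m]≤2^[7+m] zero    = ≤-refl
16*[8+m]≤2^[7+m] (suc m) = begin
  16 * (9 + m)                   ≡⟨ regroup m ⟩
  16 + 16 * (8 + m)              ≤⟨ +-monoˡ-≤ (16 * (8 + m)) (m≤m*n 16 (8 + m)) ⟩
  16 * (8 + m) + 16 * (8 + m)    ≡⟨ cong (16 * (8 + m) +_) (+-identityʳ _) ⟨
  2 * (16 * (8 + m))             ≤⟨ *-monoʳ-≤ 2 (16*[8+m]≤2^[7+m] m) ⟩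
  2 ^ (8 + m)                    ∎
  where
  open ≤-Reasoning
  regroup : ∀ m → 16 * (9 + m) ≡ 16 + 16 * (8 + m)
  regroup = solve-∀

16*suc⌊log₂n⌋≤n : ∀ {n} → 128 ≤ n → 16 * suc ⌊log₂ n ⌋ ≤ n
16*suc⌊log₂n⌋≤n {n@(suc _)} 128≤n with m≤n⇒∃[o]m+o≡n (2^m≤n⇒m≤⌊log₂n⌋ 7 {n} 128≤n)
... | m , eq = ≤-trans (subst (λ l → 16 * suc l ≤ 2 ^ l) eq (16*[8+m]≤2^[7+m] m)) (2^⌊log₂n⌋≤n n)

module Parameters (L : ℕ) (128≤L : 128 ≤ L) where

  -- `L` is the binary logarithm of `n`. For `b = 2 ^ (3 * ρ)` the gadgets need at most
  -- `2 ^ (12 * ρ + 2)` vertices, and `ρ = L / 16` keeps this below `2 ^ L`. The choice of `k` gives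
  -- `(2 + 2 * ρ) ^ k ≤ 2 ^ ρ`, because `2 + 2 * ρ ≤ 2 ^ suc ℓ`.
  ℓ ρ k : ℕ
  ℓ = ⌊log₂ L ⌋
  ρ = L / 16
  k = ρ / suc ℓ

  7≤ℓ : 7 ≤ ℓ
  7≤ℓ = 2^m≤n⇒m≤⌊log₂n⌋ 7 128≤L

  -- This guarantees `1 ≤ k`, so that rounding down in `k` costs at most a factor 2.
  suc-ℓ≤ρ : suc ℓ ≤ ρ
  suc-ℓ≤ρ = m<1+n⇒m≤n (*-cancelˡ-< 16 _ _ (begin-strict
    16 * suc ℓ     ≤⟨ 16*suc⌊log₂n⌋≤n 128≤L ⟩
    L              <⟨ m<[1+m/n]*n L 16 ⟩
    suc ρ * 16     ≡⟨ *-comm (suc ρ) 16 ⟩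
    16 * suc ρ     ∎))
    where open ≤-Reasoning

  8≤ρ : 8 ≤ ρ
  8≤ρ = ≤-trans (s≤s 7≤ℓ) suc-ℓ≤ρ

  16ρ≤L : 16 * ρ ≤ L
  16ρ≤L = ≤-trans (≤-reflexive (*-comm 16 ρ)) (m/n*n≤m L 16)

  2+2ρ≤2^sucℓ : 2 + 2 * ρ ≤ 2 ^ suc ℓ
  2+2ρ≤2^sucℓ = begin
    2 + 2 * ρ       ≤⟨ +-monoˡ-≤ (2 * ρ) (≤-trans (s≤s (s≤s z≤n)) 8≤ρ) ⟩
    3 * ρ           ≤⟨ *-monoˡ-≤ ρ {3} {16} (s≤s (s≤s (s≤s z≤n))) ⟩
    16 * ρ          ≤⟨ 16ρ≤L ⟩
    L               ≤⟨ <⇒≤ (n<2^[1+⌊log₂n⌋] L) ⟩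
    2 ^ suc ℓ       ∎
    where open ≤-Reasoning

  fits : 4 * (3 * ρ) + 2 ≤ L
  fits = begin
    4 * (3 * ρ) + 2      ≤⟨ +-monoʳ-≤ (4 * (3 * ρ)) (≤-trans (s≤s (s≤s z≤n)) 8≤ρ) ⟩
    4 * (3 * ρ) + ρ      ≤⟨ +-monoʳ-≤ (4 * (3 * ρ)) (m≤n*m ρ 4) ⟩
    4 * (3 * ρ) + 4 * ρ  ≡⟨ regroup ρ ⟩
    16 * ρ               ≤⟨ 16ρ≤L ⟩
    L                    ∎
    where
    open ≤-Reasoning
    regroup : ∀ ρ → 4 * (3 * ρ) + 4 * ρ ≡ 16 * ρ
    regroup = solve-∀

  L≤32ρ : L ≤ 32 * ρ
  L≤32ρ = begin
    L                ≤⟨ <⇒≤ (m<[1+m/n]*n L 16) ⟩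
    suc ρ * 16       ≤⟨ *-monoˡ-≤ 16 (suc≤2* (≤-trans (s≤s z≤n) 8≤ρ)) ⟩
    2 * ρ * 16       ≡⟨ regroup ρ ⟩
    32 * ρ           ∎
    where
    open ≤-Reasoning
    regroup : ∀ ρ → 2 * ρ * 16 ≡ 32 * ρ
    regroup = solve-∀

  ρ≤4kℓ : ρ ≤ 4 * (k * ℓ)
  ρ≤4kℓ = begin
    ρ                    ≤⟨ <⇒≤ (m<[1+m/n]*n ρ (suc ℓ)) ⟩
    suc k * suc ℓ        ≤⟨ *-mono-≤ (suc≤2* (m≥n⇒m/n>0 suc-ℓ≤ρ)) (suc≤2* (≤-trans (s≤s z≤n) 7≤ℓ)) ⟩
    (2 * k) * (2 * ℓ)    ≡⟨ regroup k ℓ ⟩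
    4 * (k * ℓ)          ∎
    where
    open ≤-Reasoning
    regroup : ∀ k ℓ → (2 * k) * (2 * ℓ) ≡ 4 * (k * ℓ)
    regroup = solve-∀

  -- The constant is `32 ^ 2 * 4`: one factor `ρ` of the square is kept, the other is traded for
  -- `4 * (k * ℓ)`.
  L²≤4096ρkℓ : L ^ 2 ≤ 4096 * (ρ * k * ℓ)
  L²≤4096ρkℓ = begin
    L ^ 2                          ≤⟨ ^-monoˡ-≤ 2 L≤32ρ ⟩
    (32 * ρ) ^ 2                   ≡⟨ square ρ ⟩
    1024 * ρ * ρ                   ≤⟨ *-monoʳ-≤ (1024 * ρ) ρ≤4kℓ ⟩
    1024 * ρ * (4 * (k * ℓ))       ≡⟨ regroup ρ k ℓ ⟩
    4096 * (ρ * k * ℓ)             ∎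
    where
    open ≤-Reasoning
    square : ∀ ρ → 32 * ρ * (32 * ρ * 1) ≡ 1024 * ρ * ρ
    square = solve-∀
    regroup : ∀ ρ k ℓ → 1024 * ρ * (4 * (k * ℓ)) ≡ 4096 * (ρ * k * ℓ)
    regroup = solve-∀

-- The bound after taking logarithms and clearing the denominator. Passing from natural logarithms
-- to rounded binary ones changes only the constant.
theorem1p4 : ∃[ k ] ∃[ n₀ ] ∀ (n : ℕ) → n₀ ≤ n →
    Σ (Digraph n) λ D → Acyclic D × ThreeDegenerate D ×
    (∀ (N : ℕ) → AllTournamentsContain N D →
    ⌊log₂ n ⌋ ^ 2 ≤ suc k * (⌊log₂ N ⌋ * ⌊log₂ ⌊log₂ n ⌋ ⌋))
-- The statement multiplies by `suc k`, so `4095` yields `4096`. The threshold `2 ^ 128` makes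
-- `⌊log₂ n ⌋` at least `128`, as `Parameters` requires.
theorem1p4 = 4095 , 2 ^ 128 , proof
  where
  proof : ∀ n → 2 ^ 128 ≤ n → Σ (Digraph n) λ D → Acyclic D × ThreeDegenerate D ×
    (∀ N → AllTournamentsContain N D → ⌊log₂ n ⌋ ^ 2 ≤ 4096 * (⌊log₂ N ⌋ * ⌊log₂ ⌊log₂ n ⌋ ⌋))
  proof zero 2^128≤0 = contradiction 2^128≤0 (<⇒≱ (m^n>0 2 128))
  proof n@(suc _) 2^128≤n =
    let D , acyclic , threeDegenerate , bound =
          ramsey-lower-bound {t = 1 + 2 * ρ} k (2^m^n<2^pairs ρ)
            (capacity<2^3ρ {k = k} (≤-trans (s≤s (s≤s z≤n)) 8≤ρ) 2+2ρ≤2^sucℓ (m/n*n≤m ρ (suc ℓ)))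
            (≤-trans (gadgets-fit (3 * ρ)) (≤-trans (^-monoʳ-≤ 2 fits) (2^⌊log₂n⌋≤n n)))
    -- The host has `(2 ^ ρ) ^ k = 2 ^ (ρ * k)` vertices, fewer than `N`, so `ρ * k ≤ ⌊log₂ N ⌋`.
    in D , acyclic , threeDegenerate , λ N contain → ≤-trans L²≤4096ρkℓ
      (*-monoʳ-≤ 4096 (*-monoˡ-≤ ℓ (2^m≤n⇒m≤⌊log₂n⌋ (ρ * k)
        (≤-trans (≤-reflexive (sym (^-*-assoc 2 ρ k))) (<⇒≤ (bound N contain))))))
    where
    open Parameters ⌊log₂ n ⌋ (2^m≤n⇒m≤⌊log₂n⌋ 128 2^128≤n)
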